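{- Let $\mathcal{C}$ be the category of C-systems and their homomorphisms and let $\mathcal{B}$ be the category of unital pre-B-systems and their homomorphisms. The functor $\mathcal{C}\to\mathcal{B}$, $CC\mapsto uB(CC)$ (acting on a homomorphism of C-systems by restricting it to objects of each length and to sections), is a full embedding, i.e. a fully faithful functor.
   Context: A C0-system is a category $CC$ together with: a function $l:Ob(CC)\to\mathbb{N}$ (length), an object $pt$, a function $ft:Ob(CC)\to Ob(CC)$, for every object $X$ a morphism $p_X:X\to ft(X)$, and for every $X$ with $l(X)>0$ and every morphism $f:Y\to ft(X)$ an object $f^*X$ and a morphism $q(f,X):f^*X\to X$, such that: (i) $pt$ is the only object of length $0$; (ii) $l(ft(X))=l(X)-1$ if $l(X)>0$, and $ft(pt)=pt$; (iii) $pt$ is a final object; (iv) for $l(X)>0$ and $f:Y\to ft(X)$ one has $l(f^*X)>0$, $ft(f^*X)=Y$, $p_X\circ q(f,X)=f\circ p_{f^*X}$, and this commutative square is a pullback square; (v) $(id_{ft(X)})^*X=X$ and $q(id_{ft(X)},X)=id_X$; (vi) for $g:Z\to Y$, $f:Y\to ft(X)$: $(f\circ g)^*X=g^*(f^*X)$ and $q(f\circ g,X)=q(f,X)\circ q(g,f^*X)$. A C-system is a C0-system together with, for every morphism $f:Y\to X$ with $l(X)>0$, a morphism $s_f:Y\to (ft(f))^*X$, where $ft(f):=p_X\circ f$, such that $p_{(ft(f))^*X}\circ s_f=id_Y$, $q(ft(f),X)\circ s_f=f$, and whenever $X=g^*U$ for some $U$ with $l(U)>0$ and $g:ft(X)\to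 ft(U)$, one has $s_f=s_{q(g,U)\circ f}$. A homomorphism of C-systems is a functor commuting with $l$, $pt$, $ft$, $p$, $(-)^*$, $q$ and $s$. A non-unital pre-B-system consists of sets $B_n$ and $\widetilde B_{n+1}$ ($n\ge 0$), maps $ft:B_{n+1}\to B_n$, $\partial:\widetilde B_{n+1}\to B_{n+1}$, an element $pt\in B_0$, and for all $m\ge n\ge 0$ maps $T:\{(Y,X)\in B_{n+1}\times B_{m+1}\mid ft(Y)=ft^{m+1-n}(X)\}\to B_{m+2}$, $\widetilde T:\{(Y,r)\in B_{n+1}\times\widetilde B_{m+1}\mid ft(Y)=ft^{m+1-n}(\partial r)\}\to\widetilde B_{m+2}$, $S:\{(s,X)\in\widetilde B_{n+1}\times B_{m+2}\mid \partial(s)=ft^{m+1-n}(X)\}\to B_{m+1}$, $\widetilde S:\{(s,r)\in\widetilde B_{n+1}\times\widetilde B_{m+2}\mid \partial(s)=ft^{m+1-n}(\partial r)\}\to\widetilde B_{m+1}$. A unital pre-B-system additionally has maps $\delta:B_{n+1}\to\widetilde B_{n+2}$ ($n\ge0$). A homomorphism of unital pre-B-systems is a family of maps $B_n\to B'_n$, $\widetilde B_{n+1}\to\widetilde B'_{n+1}$ commuting with $ft,\partial,pt,T,\widetilde T,S,\widetilde S,\delta$. For a C-system $CC$, $uB(CC)$ is the unital pre-B-system with $B_n=\{X\mid l(X)=n\}$, $\widetilde B_{n+1}=\{(X,s)\mid l(X)=n+1,\ s:ft(X)\to X,\ p_X\circ s=id_{ft(X)}\}$, $ft$ the restriction of $ft$,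 $\partial(X,s)=X$, $pt=pt$, and operations defined as follows. For $l(X)\ge i$ and $f:Y\to ft^i(X)$ put $f^*(X,0)=Y$, $q(f,X,0)=f$, $f^*(X,i+1)=q(f,ft(X),i)^*(X)$, $q(f,X,i+1)=q(q(f,ft(X),i),X)$. For a section $s:ft(X)\to X$ of $p_X$ and $g:W\to ft(X)$, let $g^*(s):W\to g^*X$ be the unique morphism with $p_{g^*X}\circ g^*(s)=id_W$ and $q(g,X)\circ g^*(s)=s\circ g$; for $i\ge1$, $l(X)\ge i$, $f:Y\to ft^i(X)$ put $f^*(s,i)=q(f,ft(X),i-1)^*(s):f^*(ft(X),i-1)\to f^*(X,i)$. Then for $m\ge n\ge 0$: $T(Y,X)=p_Y^*(X,m+1-n)$; $\widetilde T(Y,(X,s))=(p_Y^*(X,m+1-n),p_Y^*(s,m+1-n))$; $S((Z,s),X)=s^*(X,m+1-n)$; $\widetilde S((Z,s),(X,r))=(s^*(X,m+1-n),s^*(r,m+1-n))$ (with $s:ft(Z)\to Z$, $Z=ft^{m+1-n}(X)$); and $\delta(X)=(p_X^*X,d_X)$ where $d_X:X\to p_X^*X$ is the unique morphism with $p_{p_X^*X}\circ d_X=id_X$ and $q(p_X,X)\circ d_X=id_X$. -}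

module Defs where

open import Level using (Level; _⊔_) renaming (suc to lsuc)
open import Data.Nat using (ℕ; zero; suc; _+_; _∸_; _≤_; _<_; z≤n; s≤s)
open import Data.Nat.Properties using (+-suc; +-comm; +-identityʳ; m≤m+n; ≤-trans; ∸-monoˡ-≤)
open import Data.Product using (Σ; _×_; _,_; proj₁; proj₂)
open import Relation.Binary.PropositionalEquality
  using (_≡_; refl; sym; trans; cong; subst)
open import Relation.Binary.HeterogeneousEquality using (_≅_; ≅-to-≡)

-- Categories (objects and hom-types; with K every type is a set)

record Category (o h : Level) : Set (lsuc (o ⊔ h)) where
  infixr 9 _∘_
  field
    Ob    : Set o
    Hom   : Ob → Ob → Set h
    id    : ∀ {A} → Hom A A
    _∘_   : ∀ {A B C} → Hom B C → Hom A B → Hom A C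
    idˡ   : ∀ {A B} (f : Hom A B) → id ∘ f ≡ f
    idʳ   : ∀ {A B} (f : Hom A B) → f ∘ id ≡ f
    assoc : ∀ {A B C D} (f : Hom C D) (g : Hom B C) (k : Hom A B) →
            (f ∘ g) ∘ k ≡ f ∘ (g ∘ k)

IsPullback : ∀ {o h} (𝒞 : Category o h) → let open Category 𝒞 in
  ∀ {P X Y Z} → Hom P X → Hom P Y → Hom X Z → Hom Y Z → Set (o ⊔ h)
IsPullback 𝒞 {P} {X} {Y} {Z} qq pp px f =
  ∀ {W} (a : Hom W X) (b : Hom W Y) → px ∘ a ≡ f ∘ b →
  Σ (Hom W P) λ u → ((qq ∘ u ≡ a) × (pp ∘ u ≡ b)) ×
                    (∀ u' → qq ∘ u' ≡ a → pp ∘ u' ≡ b → u' ≡ u)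
  where open Category 𝒞

record CSystem (o h : Level) : Set (lsuc (o ⊔ h)) where
  field
    cat : Category o h
  open Category cat
  field
    l   : Ob → ℕ
    pt  : Ob
    ft  : Ob → Ob
    p   : (X : Ob) → Hom X (ft X)
    pb  : (X : Ob) → .(0 < l X) → {Y : Ob} → Hom Y (ft X) → Ob
    q   : (X : Ob) .(h : 0 < l X) {Y : Ob} (f : Hom Y (ft X)) → Hom (pb X h f) X
    l-pt  : l pt ≡ 0
    l≡0   : ∀ X → l X ≡ 0 → X ≡ pt
    l-ft  : ∀ X → 0 < l X → l (ft X) ≡ l X ∸ 1
    ft-pt : ft pt ≡ pt
    final : ∀ X → Σ (Hom X pt) λ t → ∀ g → g ≡ t
    pb-pos : ∀ X .(h : 0 < l X) {Y} (f : Hom Y (ft X)) → 0 < l (pb X h f)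
    ft-pb  : ∀ X .(h : 0 < l X) {Y} (f : Hom Y (ft X)) → ft (pb X h f) ≡ Y
    pb-sq  : ∀ X .(h : 0 < l X) {Y} (f : Hom Y (ft X)) →
             p X ∘ q X h f ≡ f ∘ subst (Hom (pb X h f)) (ft-pb X h f) (p (pb X h f))
    pb-pullback : ∀ X .(h : 0 < l X) {Y} (f : Hom Y (ft X)) →
             IsPullback cat (q X h f) (subst (Hom (pb X h f)) (ft-pb X h f) (p (pb X h f))) (p X) f
    pb-id  : ∀ X .(h : 0 < l X) → pb X h id ≡ X
    q-id   : ∀ X .(h : 0 < l X) → q X h id ≅ id {X}
    pb-∘   : ∀ X .(h : 0 < l X) {Y Z} (f : Hom Y (ft X)) (g : Hom Z Y) →
             pb X h (f ∘ g) ≡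
             pb (pb X h f) (pb-pos X h f) (subst (Hom Z) (sym (ft-pb X h f)) g)
    q-∘    : ∀ X .(h : 0 < l X) {Y Z} (f : Hom Y (ft X)) (g : Hom Z Y) →
             q X h (f ∘ g) ≅
             q X h f ∘ q (pb X h f) (pb-pos X h f) (subst (Hom Z) (sym (ft-pb X h f)) g)
    s      : ∀ {Y X} .(h : 0 < l X) (f : Hom Y X) → Hom Y (pb X h (p X ∘ f))
    s-sec  : ∀ {Y X} .(h : 0 < l X) (f : Hom Y X) →
             subst (Hom (pb X h (p X ∘ f))) (ft-pb X h (p X ∘ f)) (p (pb X h (p X ∘ f))) ∘ s h f
               ≡ id
    s-q    : ∀ {Y X} .(h : 0 < l X) (f : Hom Y X) → q X h (p X ∘ f) ∘ s h f ≡ f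
    s-nat  : ∀ {Y X} .(hX : 0 < l X) (f : Hom Y X)
               {U} .(hU : 0 < l U) (g : Hom (ft X) (ft U)) (e : X ≡ pb U hU g) →
             s hX f ≅ s hU (q U hU g ∘ subst (Hom Y) e f)
  open Category cat public

record CHom {o h o' h'} (C : CSystem o h) (C' : CSystem o' h') : Set (o ⊔ h ⊔ o' ⊔ h') where
  private
    module C = CSystem C
    module C' = CSystem C'
  field
    F₀   : C.Ob → C'.Ob
    F₁   : ∀ {A B} → C.Hom A B → C'.Hom (F₀ A) (F₀ B)
    F-id : ∀ {A} → F₁ (C.id {A}) ≡ C'.id
    F-∘  : ∀ {A B D} (f : C.Hom B D) (g : C.Hom A B) → F₁ (f C.∘ g) ≡ F₁ f C'.∘ F₁ g
    F-l  : ∀ X → C'.l (F₀ X) ≡ C.l X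
    F-pt : F₀ C.pt ≡ C'.pt
    F-ft : ∀ X → F₀ (C.ft X) ≡ C'.ft (F₀ X)
    F-p  : ∀ X → F₁ (C.p X) ≅ C'.p (F₀ X)
    F-pb : ∀ X .(h : 0 < C.l X) {Y} (f : C.Hom Y (C.ft X)) →
           F₀ (C.pb X h f) ≡
           C'.pb (F₀ X) (subst (0 <_) (sym (F-l X)) h) (subst (C'.Hom (F₀ Y)) (F-ft X) (F₁ f))
    F-q  : ∀ X .(h : 0 < C.l X) {Y} (f : C.Hom Y (C.ft X)) →
           F₁ (C.q X h f) ≅
           C'.q (F₀ X) (subst (0 <_) (sym (F-l X)) h) (subst (C'.Hom (F₀ Y)) (F-ft X) (F₁ f))
    F-s  : ∀ {Y X} .(h : 0 < C.l X) (f : C.Hom Y X) →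
           F₁ (C.s h f) ≅ C'.s (subst (0 <_) (sym (F-l X)) h) (F₁ f)

-- Unital pre-B-systems.  Bt n stands for  \widetilde B_{n+1}.
-- The operations for m ≥ n are indexed by (n , k) with m = k + n.

iter-ft : ∀ {b} (B : ℕ → Set b) (ft : ∀ {n} → B (suc n) → B n) →
          (k : ℕ) {n : ℕ} → B (k + n) → B n
iter-ft B ft zero    X = X
iter-ft B ft (suc k) X = iter-ft B ft k (ft X)

record PreB (b bt : Level) : Set (lsuc (b ⊔ bt)) where
  field
    B   : ℕ → Set b
    Bt  : ℕ → Set bt
    ft  : ∀ {n} → B (suc n) → B n
    ∂   : ∀ {n} → Bt n → B (suc n)
    pt  : B 0
  ftⁱ : (k : ℕ) {n : ℕ} → B (k + n) → B n
  ftⁱ = iter-ft B ft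
  field
    T   : ∀ n k (Y : B (suc n)) (X : B (suc k + n)) →
          ft Y ≡ ftⁱ (suc k) X → B (suc (suc k + n))
    Tt  : ∀ n k (Y : B (suc n)) (r : Bt (k + n)) →
          ft Y ≡ ftⁱ (suc k) (∂ r) → Bt (suc (k + n))
    S   : ∀ n k (σ : Bt n) (X : B (suc k + suc n)) →
          ∂ σ ≡ ftⁱ (suc k) X → B (k + suc n)
    St  : ∀ n k (σ : Bt n) (r : Bt (k + suc n)) →
          ∂ σ ≡ ftⁱ (suc k) (∂ r) → Bt (k + n)
    δ   : ∀ {n} → B (suc n) → Bt (suc n)

record PreBMaps {b bt b' bt'} (P : PreB b bt) (P' : PreB b' bt') : Set (b ⊔ bt ⊔ b' ⊔ bt') where
  private
    module P = PreB P
    module P' = PreB P'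
  field
    Bmap  : ∀ {n} → P.B n → P'.B n
    Btmap : ∀ {n} → P.Bt n → P'.Bt n

-- the homomorphism conditions (the compatibility proofs for the
-- image arguments are quantified over; with K they are unique)
record IsPreBHom {b bt b' bt'} (P : PreB b bt) (P' : PreB b' bt')
                 (M : PreBMaps P P') : Set (b ⊔ bt ⊔ b' ⊔ bt') where
  private
    module P = PreB P
    module P' = PreB P'
  open PreBMaps M
  field
    ft-comm : ∀ {n} (X : P.B (suc n)) → Bmap (P.ft X) ≡ P'.ft (Bmap X)
    ∂-comm  : ∀ {n} (r : P.Bt n) → Bmap (P.∂ r) ≡ P'.∂ (Btmap r)
    pt-comm : Bmap P.pt ≡ P'.pt
    T-comm  : ∀ n k Y X e e' → Bmap (P.T n k Y X e) ≡ P'.T n k (Bmap Y) (Bmap X) e'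
    Tt-comm : ∀ n k Y r e e' → Btmap (P.Tt n k Y r e) ≡ P'.Tt n k (Bmap Y) (Btmap r) e'
    S-comm  : ∀ n k σ X e e' → Bmap (P.S n k σ X e) ≡ P'.S n k (Btmap σ) (Bmap X) e'
    St-comm : ∀ n k σ r e e' → Btmap (P.St n k σ r e) ≡ P'.St n k (Btmap σ) (Btmap r) e'
    δ-comm  : ∀ {n} (X : P.B (suc n)) → Btmap (P.δ X) ≡ P'.δ (Bmap X)

record PreBHom {b bt b' bt'} (P : PreB b bt) (P' : PreB b' bt') : Set (b ⊔ bt ⊔ b' ⊔ bt') where
  field
    maps  : PreBMaps P P'
    isHom : IsPreBHom P P' maps
  open PreBMaps maps public

_≈ᴹ_ : ∀ {b bt b' bt'} {P : PreB b bt} {P' : PreB b' bt'} →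
       PreBMaps P P' → PreBMaps P P' → Set (b ⊔ bt ⊔ b' ⊔ bt')
_≈ᴹ_ {P = P} M N =
  (∀ {n} (X : PreB.B P n) → PreBMaps.Bmap M X ≡ PreBMaps.Bmap N X) ×
  (∀ {n} (r : PreB.Bt P n) → PreBMaps.Btmap M r ≡ PreBMaps.Btmap N r)

sucpred : ∀ m → 0 < m → suc (m ∸ 1) ≡ m
sucpred (suc m) _ = refl

module _ {o h} (𝒞 : Category o h) where
  open Category 𝒞
  sec-cast : ∀ {A W Z} (e : A ≡ W) (pp : Hom Z A) (u : Hom W Z) →
             subst (Hom Z) e pp ∘ u ≡ id → pp ∘ subst (λ V → Hom V Z) (sym e) u ≡ id
  sec-cast refl pp u eq = eq

module UB {o h} (C : CSystem o h) where
  open CSystem C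

  ftⁱᴼ : ℕ → Ob → Ob
  ftⁱᴼ zero    X = X
  ftⁱᴼ (suc i) X = ftⁱᴼ i (ft X)

  l-ft' : ∀ X → 0 < l X → suc (l (ft X)) ≡ l X
  l-ft' X h = trans (cong suc (l-ft X h)) (sucpred (l X) h)

  pos : ∀ {i X} → suc i ≤ l X → 0 < l X
  pos h = ≤-trans (s≤s z≤n) h

  pred≤ : ∀ {i} X → suc i ≤ l X → i ≤ l (ft X)
  pred≤ X h = subst (_ ≤_) (sym (l-ft X (pos h))) (∸-monoˡ-≤ 1 h)

  mutual
    pbi : (i : ℕ) (X : Ob) .(h : i ≤ l X) {Y : Ob} → Hom Y (ftⁱᴼ i X) → Ob
    pbi zero    X h {Y} f = Y
    pbi (suc i) X h     f = pb X (pos h) (qi i (ft X) (pred≤ X h) f)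

    qi : (i : ℕ) (X : Ob) .(h : i ≤ l X) {Y : Ob} (f : Hom Y (ftⁱᴼ i X)) → Hom (pbi i X h f) X
    qi zero    X h f = f
    qi (suc i) X h f = q X (pos h) (qi i (ft X) (pred≤ X h) f)

  l-pb : ∀ X .(h : 0 < l X) {Y} (f : Hom Y (ft X)) → l (pb X h f) ≡ suc (l Y)
  l-pb X h {Y} f = trans (sym (l-ft' (pb X h f) (pb-pos X h f))) (cong (λ V → suc (l V)) (ft-pb X h f))

  l-pbi : ∀ i X .(h : i ≤ l X) {Y} (f : Hom Y (ftⁱᴼ i X)) → l (pbi i X h f) ≡ l Y + i
  l-pbi zero    X h {Y} f = sym (+-identityʳ (l Y))
  l-pbi (suc i) X h {Y} f =
    trans (l-pb X (pos h) (qi i (ft X) (pred≤ X h) f))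
          (trans (cong suc (l-pbi i (ft X) (pred≤ X h) f)) (sym (+-suc (l Y) i)))

  mkSec : ∀ X .(h : 0 < l X) {W} (g : Hom W (ft X)) (u : Hom W (pb X h g)) →
          subst (Hom (pb X h g)) (ft-pb X h g) (p (pb X h g)) ∘ u ≡ id →
          Σ (Hom (ft (pb X h g)) (pb X h g)) λ σ → p (pb X h g) ∘ σ ≡ id
  mkSec X h g u eq = subst (λ V → Hom V (pb X h g)) (sym (ft-pb X h g)) u
                   , sec-cast cat (ft-pb X h g) (p (pb X h g)) u eq

  pbSec : ∀ X .(h : 0 < l X) (σ : Hom (ft X) X) → p X ∘ σ ≡ id →
          ∀ {W} (g : Hom W (ft X)) →
          Σ (Hom (ft (pb X h g)) (pb X h g)) λ σ' → p (pb X h g) ∘ σ' ≡ id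
  pbSec X h σ ps g = mkSec X h g (proj₁ U) (proj₂ (proj₁ (proj₂ U)))
    where
    sqp : p X ∘ (σ ∘ g) ≡ g ∘ id
    sqp = trans (sym (assoc (p X) σ g))
                (trans (cong (_∘ g) ps) (trans (idˡ g) (sym (idʳ g))))
    U = pb-pullback X h g (σ ∘ g) id sqp

  diag : ∀ X .(h : 0 < l X) →
         Σ (Hom (ft (pb X h (p X))) (pb X h (p X))) λ σ → p (pb X h (p X)) ∘ σ ≡ id
  diag X h = mkSec X h (p X) (proj₁ U) (proj₂ (proj₁ (proj₂ U)))
    where U = pb-pullback X h (p X) id id refl

  Bᵘ : ℕ → Set o
  Bᵘ n = Σ Ob λ X → l X ≡ n

  Btᵘ : ℕ → Set (o ⊔ h)
  Btᵘ n = Σ Ob λ X → (l X ≡ suc n) × (Σ (Hom (ft X) X) λ σ → p X ∘ σ ≡ id)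

  ftᵘ : ∀ {n} → Bᵘ (suc n) → Bᵘ n
  ftᵘ (X , e) = ft X , trans (l-ft X (subst (0 <_) (sym e) (s≤s z≤n))) (cong (_∸ 1) e)

  ∂ᵘ : ∀ {n} → Btᵘ n → Bᵘ (suc n)
  ∂ᵘ (X , e , _) = X , e

  proj-iter : ∀ k {n} (X : Bᵘ (k + n)) → proj₁ (iter-ft Bᵘ ftᵘ k X) ≡ ftⁱᴼ k (proj₁ X)
  proj-iter zero    X = refl
  proj-iter (suc k) X = proj-iter k (ftᵘ X)

  len≤ : ∀ {k m} X → l X ≡ suc k + m → suc k ≤ l X
  len≤ {k} {m} X e = subst (suc k ≤_) (sym e) (m≤m+n (suc k) m)

  arithT : ∀ n k → suc n + suc k ≡ suc (suc k + n)
  arithT n k = cong suc (trans (+-suc n k) (cong suc (+-comm n k)))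

  arithS : ∀ n k → n + suc k ≡ k + suc n
  arithS n k = trans (+-suc n k) (trans (cong suc (+-comm n k)) (sym (+-suc k n)))

  l-ftB : ∀ {n} Z → l Z ≡ suc n → l (ft Z) ≡ n
  l-ftB Z e = proj₂ (ftᵘ (Z , e))

  Tᵘ : ∀ n k (Y : Bᵘ (suc n)) (X : Bᵘ (suc k + n)) →
       ftᵘ Y ≡ iter-ft Bᵘ ftᵘ (suc k) X → Bᵘ (suc (suc k + n))
  Tᵘ n k (Y , eY) (X , eX) e =
    pbi (suc k) X (len≤ X eX) f ,
    trans (l-pbi (suc k) X (len≤ X eX) f) (trans (cong (_+ suc k) eY) (arithT n k))
    where f = subst (Hom Y) (trans (cong proj₁ e) (proj-iter (suc k) (X , eX))) (p Y)

  Ttᵘ : ∀ n k (Y : Bᵘ (suc n)) (r : Btᵘ (k + n)) →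
        ftᵘ Y ≡ iter-ft Bᵘ ftᵘ (suc k) (∂ᵘ r) → Btᵘ (suc (k + n))
  Ttᵘ n k (Y , eY) (X , eX , σ , ps) e =
    pbi (suc k) X (len≤ {k} {n} X eX) f ,
    trans (l-pbi (suc k) X (len≤ {k} {n} X eX) f) (trans (cong (_+ suc k) eY) (arithT n k)) ,
    pbSec X (pos (len≤ {k} {n} X eX)) σ ps (qi k (ft X) (pred≤ X (len≤ {k} {n} X eX)) f)
    where f = subst (Hom Y) (trans (cong proj₁ e) (proj-iter (suc k) (X , eX))) (p Y)

  Sᵘ : ∀ n k (σ : Btᵘ n) (X : Bᵘ (suc k + suc n)) →
       ∂ᵘ σ ≡ iter-ft Bᵘ ftᵘ (suc k) X → Bᵘ (k + suc n)
  Sᵘ n k (Z , eZ , σ , ps) (X , eX) e =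
    pbi (suc k) X (len≤ X eX) f ,
    trans (l-pbi (suc k) X (len≤ X eX) f) (trans (cong (_+ suc k) (l-ftB Z eZ)) (arithS n k))
    where f = subst (Hom (ft Z)) (trans (cong proj₁ e) (proj-iter (suc k) (X , eX))) σ

  Stᵘ : ∀ n k (σ : Btᵘ n) (r : Btᵘ (k + suc n)) →
        ∂ᵘ σ ≡ iter-ft Bᵘ ftᵘ (suc k) (∂ᵘ r) → Btᵘ (k + n)
  Stᵘ n k (Z , eZ , σ , ps) (X , eX , ρ , pr) e =
    pbi (suc k) X (len≤ {k} {suc n} X eX) f ,
    trans (l-pbi (suc k) X (len≤ {k} {suc n} X eX) f)
          (trans (cong (_+ suc k) (l-ftB Z eZ)) (trans (+-suc n k) (cong suc (+-comm n k)))) ,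
    pbSec X (pos (len≤ {k} {suc n} X eX)) ρ pr (qi k (ft X) (pred≤ X (len≤ {k} {suc n} X eX)) f)
    where f = subst (Hom (ft Z)) (trans (cong proj₁ e) (proj-iter (suc k) (X , eX))) σ

  δᵘ : ∀ {n} → Bᵘ (suc n) → Btᵘ (suc n)
  δᵘ (X , eX) = pb X hp (p X) , trans (l-pb X hp (p X)) (cong suc eX) , diag X hp
    where hp = subst (0 <_) (sym eX) (s≤s z≤n)

  uB : PreB o (o ⊔ h)
  uB = record
    { B = Bᵘ ; Bt = Btᵘ ; ft = ftᵘ ; ∂ = ∂ᵘ ; pt = pt , l-pt
    ; T = Tᵘ ; Tt = Ttᵘ ; S = Sᵘ ; St = Stᵘ ; δ = δᵘ }

open UB public using (uB)

module _ {o h} (𝒞 : Category o h) where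
  open Category 𝒞
  sec-cast₂ : ∀ {A A' Z} (e : A ≡ A') (P : Hom Z A) (P' : Hom Z A') (σ : Hom A Z) →
              P ≅ P' → P ∘ σ ≡ id → P' ∘ subst (λ V → Hom V Z) e σ ≡ id
  sec-cast₂ refl P P' σ eq ps = subst (λ R → R ∘ σ ≡ id) (≅-to-≡ eq) ps

module UBHom {o h o' h'} {C : CSystem o h} {C' : CSystem o' h'} (F : CHom C C') where
  private
    module C = CSystem C
    module C' = CSystem C'
  open CHom F

  Bmapᵘ : ∀ {n} → UB.Bᵘ C n → UB.Bᵘ C' n
  Bmapᵘ (X , e) = F₀ X , trans (F-l X) e

  Btmapᵘ : ∀ {n} → UB.Btᵘ C n → UB.Btᵘ C' n
  Btmapᵘ (X , e , σ , ps) =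
    F₀ X , trans (F-l X) e ,
    subst (λ V → C'.Hom V (F₀ X)) (F-ft X) (F₁ σ) ,
    sec-cast₂ C'.cat (F-ft X) (F₁ (C.p X)) (C'.p (F₀ X)) (F₁ σ) (F-p X)
              (trans (sym (F-∘ (C.p X) σ)) (trans (cong F₁ ps) F-id))

uB-maps : ∀ {o h o' h'} {C : CSystem o h} {C' : CSystem o' h'} →
          CHom C C' → PreBMaps (uB C) (uB C')
uB-maps F = record { Bmap = UBHom.Bmapᵘ F ; Btmap = UBHom.Btmapᵘ F }

{-# OPTIONS --safe #-}
module Submission where

open import Defs
open import Level using (Level; _⊔_)
open import Data.Nat using (ℕ; zero; suc; _+_; _≤_; _<_; z≤n; s≤s)
open import Data.Nat.Properties using (+-suc; m≤n+m; m<m+n; _<?_; suc-injective)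
open import Data.Product using (Σ; _×_; _,_; proj₁; proj₂)
open import Relation.Binary.PropositionalEquality
  using (_≡_; refl; sym; trans; cong; subst)
open import Relation.Binary.HeterogeneousEquality using (_≅_; ≅-to-≡)
import Relation.Binary.HeterogeneousEquality as Het
open import Relation.Nullary.Decidable using (recompute)
open import Axiom.UniquenessOfIdentityProofs.WithK using (uip)

-- A morphism f : Y → X with l(X) > 0 factors as q(p_X ∘ f, X) ∘ s_f, where s_f is a section,
-- the pullback along f of the diagonal of X.  Induction on l(X) therefore shows that a
-- homomorphism of C-systems is determined by its action on objects and sections.
--
-- For fullness, let H be a homomorphism uB(CC) → uB(CC').  Call g a lift of f if pulling back
-- along g, at every depth, maps the H-images of objects and sections to the H-images of their
-- pullbacks along f.  Lifts are closed under identities, composition and q; compatibility of H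
-- with T and S says exactly that projections and sections have the expected lifts.  Hence every
-- f has a lift by the factorization above, and compatibility with δ makes it unique, since it
-- forces s_g = H(s_f).  Uniqueness turns all laws of a homomorphism into closure properties of
-- lifts.

-- Calculus of morphisms in a C-system.

module CSystemProperties {o h} (C : CSystem o h) where
  open CSystem C public
  open UB C public hiding (uB)

  -- Unlike ≅, this equality identifies the endpoints as well, so that no injectivity of Hom
  -- is needed to recover them.
  infix 4 _≈_
  data _≈_ {A B} (f : Hom A B) : ∀ {A' B'} → Hom A' B' → Set (o ⊔ h) where
    refl : f ≈ f

  private
    variable
      A A' B B' X X' Y Z : Ob
      n n' : ℕ

  ≈-sym : {f : Hom A B} {g : Hom A' B'} → f ≈ g → g ≈ f
  ≈-sym refl = refl

  ≈-trans : {f : Hom A B} {g : Hom A' B'} {k : Hom X Y} → f ≈ g → g ≈ k → f ≈ k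
  ≈-trans refl e = e

  infix  3 _∎
  infixr 2 step-≈ step-≈˘
  step-≈ : (f : Hom A B) {g : Hom A' B'} {k : Hom X Y} → g ≈ k → f ≈ g → f ≈ k
  step-≈ f e e' = ≈-trans e' e
  step-≈˘ : (f : Hom A B) {g : Hom A' B'} {k : Hom X Y} → g ≈ k → g ≈ f → f ≈ k
  step-≈˘ f e e' = ≈-trans (≈-sym e') e
  syntax step-≈  f e e' = f ≈⟨ e' ⟩ e
  syntax step-≈˘ f e e' = f ≈⟨ e' ⟨ e
  _∎ : (f : Hom A B) → f ≈ f
  f ∎ = refl

  dom-≡ : {f : Hom A B} {g : Hom A' B'} → f ≈ g → A ≡ A'
  dom-≡ refl = refl

  cod-≡ : {f : Hom A B} {g : Hom A' B'} → f ≈ g → B ≡ B'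
  cod-≡ refl = refl

  ≡⇒≈ : {f g : Hom A B} → f ≡ g → f ≈ g
  ≡⇒≈ refl = refl

  ≈⇒≡ : {f g : Hom A B} → f ≈ g → f ≡ g
  ≈⇒≡ refl = refl

  ≅⇒≈ : {f : Hom A B} {g : Hom A' B'} → A ≡ A' → B ≡ B' → f ≅ g → f ≈ g
  ≅⇒≈ refl refl e = ≡⇒≈ (≅-to-≡ e)

  ≈⇒≅ : {f : Hom A B} {g : Hom A' B'} → f ≈ g → f ≅ g
  ≈⇒≅ refl = Het.refl

  castᶜ : B ≡ B' → Hom A B → Hom A B'
  castᶜ = subst (Hom _)

  castᵈ : A ≡ A' → Hom A B → Hom A' B
  castᵈ = subst (λ V → Hom V _)

  castᶜ-≈ : (e : B ≡ B') (f : Hom A B) → castᶜ e f ≈ f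
  castᶜ-≈ refl f = refl

  castᵈ-≈ : (e : A ≡ A') (f : Hom A B) → castᵈ e f ≈ f
  castᵈ-≈ refl f = refl

  -- Matching forces `X` to be `B`. The renamed identity has the form that `qi-id` and `pull-id`
  -- expect.
  id-as : {f : Hom A B} → f ≈ id {X} → f ≈ id {B}
  id-as refl = refl

  ∘-cong : {f : Hom B X} {g : Hom A B} {f' : Hom B' X'} {g' : Hom A' B'} →
           f ≈ f' → g ≈ g' → f ∘ g ≈ f' ∘ g'
  ∘-cong refl refl = refl

  p-cong : X ≡ X' → p X ≈ p X'
  p-cong refl = refl

  q-cong : ∀ .{h h'} {f : Hom A (ft X)} {f' : Hom A' (ft X')} →
           X ≡ X' → f ≈ f' → q X h f ≈ q X' h' f'
  q-cong refl refl = refl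

  q-id-≈ : ∀ .{h} → q X h id ≈ id {X}
  q-id-≈ {X} {h} = ≅⇒≈ (pb-id X h) refl (q-id X h)

  -- The composition law for `q`, with its transport of `g` replaced by any `g'` that matches `g`,
  -- so that callers choose the representative.
  q-∘-≈ : ∀ .{h} {f : Hom Y (ft X)} .{h'} {g : Hom Z Y} {g' : Hom A (ft (pb X h f))} →
          g' ≈ g → q X h (f ∘ g) ≈ q X h f ∘ q (pb X h f) h' g'
  q-∘-≈ {X = X} {h = h} {f = f} {g = g} {g' = g'} e =
    q X h (f ∘ g)
      ≈⟨ ≅⇒≈ (pb-∘ X h f g) refl (q-∘ X h f g) ⟩
    q X h f ∘ q (pb X h f) (pb-pos X h f) (castᶜ (sym (ft-pb X h f)) g)
      ≈⟨ ∘-cong refl (q-cong refl (≈-trans (castᶜ-≈ _ g) (≈-sym e))) ⟩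
    q X h f ∘ q (pb X h f) _ g' ∎

  terminal-unique : l B ≡ 0 → (f g : Hom A B) → f ≡ g
  terminal-unique {B} {A} e f g with l≡0 B e
  ... | refl = trans (proj₂ (final A) f) (sym (proj₂ (final A) g))

  -- Pullback at depth `i`.

  qi-cong : ∀ i .{h h'} {f : Hom A (ftⁱᴼ i X)} {f' : Hom A' (ftⁱᴼ i X')} →
            X ≡ X' → f ≈ f' → qi i X h f ≈ qi i X' h' f'
  qi-cong i refl refl = refl

  ftⁱ-pbi : ∀ i X .(h : i ≤ l X) (f : Hom A (ftⁱᴼ i X)) → ftⁱᴼ i (pbi i X h f) ≡ A
  ftⁱ-pbi zero    X h f = refl
  ftⁱ-pbi (suc i) X h f =
    trans (cong (ftⁱᴼ i) (ft-pb X (pos h) (qi i (ft X) (pred≤ X h) f)))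
          (ftⁱ-pbi i (ft X) (pred≤ X h) f)

  ≤-pbi : ∀ i X .(h : i ≤ l X) (f : Hom A (ftⁱᴼ i X)) → i ≤ l (pbi i X h f)
  ≤-pbi {A} i X h f = subst (i ≤_) (sym (l-pbi i X h f)) (m≤n+m i (l A))

  qi-id : ∀ i .{h} {f : Hom A (ftⁱᴼ i X)} → f ≈ id {ftⁱᴼ i X} → qi i X h f ≈ id {X}
  qi-id zero    e = e
  qi-id {X = X} (suc i) {h} e = ≈-trans (q-cong refl (qi-id i {pred≤ X h} e)) (q-id-≈ {h = pos h})

  -- Depth `i` along `q Z hZ f` is depth `suc i` along `f`: both apply `q` for the top `i` levels,
  -- and at depth 0 the codomain of `g` identifies `Z` with `X`.
  qi-q : ∀ i {X} .{h h' hZ} {g : Hom A (ftⁱᴼ i X)} {f : Hom Y (ft Z)} {f' : Hom B (ftⁱᴼ (suc i) X)} →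
         g ≈ q Z hZ f → f' ≈ f → qi i X h g ≈ qi (suc i) X h' f'
  qi-q zero    eg ef = ≈-trans eg (q-cong (sym (cod-≡ eg)) (≈-sym ef))
  qi-q (suc i) {X} {h} {h'} {hZ} eg ef = q-cong refl (qi-q i {ft X} {pred≤ X h} {pred≤ X h'} {hZ} eg ef)

  -- `Z` and `k` are left free because the recursion meets `ft` of a pullback, which is only
  -- propositionally the pullback one level down.
  qi-∘ : ∀ i .{h h'} {f : Hom Y (ftⁱᴼ i X)} {g : Hom A Y} {g' : Hom A' (ftⁱᴼ i Z)}
         {k : Hom B (pbi i X h f)} → Z ≡ pbi i X h f → g' ≈ g → k ≈ qi i Z h' g' →
         qi i X h (f ∘ g) ≈ qi i X h f ∘ k
  qi-∘ zero refl eg ek = ∘-cong refl (≈-sym (≈-trans ek eg))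
  qi-∘ (suc i) {h} {h'} {f} {g} {g'} {k} refl eg ek =
    ≈-trans (q-cong refl (qi-∘ i {h' = pred≤ _ h'} (ft-pb _ _ _) eg (castᶜ-≈ (ft-pb _ _ _) _)))
            (≈-trans (q-∘-≈ (≈-sym (castᶜ-≈ (ft-pb _ _ _) _))) (∘-cong refl (≈-sym ek)))

  qi-∘-pbi : ∀ i {X} .{h} {f : Hom Y (ftⁱᴼ i X)} {g : Hom A Y} →
             qi i X h (f ∘ g) ≈ qi i X h f ∘
               qi i (pbi i X h f) (≤-pbi i X h f) (castᶜ (sym (ftⁱ-pbi i X h f)) g)
  qi-∘-pbi i {X} {h} {f} {g} = qi-∘ i {h' = ≤-pbi i X h f} refl (castᶜ-≈ (sym (ftⁱ-pbi i X h f)) g) refl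

  -- Sections and their pullbacks.

  q-jointly-monic : ∀ .{h} {g : Hom Y (ft X)} {u v : Hom A (pb X h g)} →
                    q X h g ∘ u ≡ q X h g ∘ v → p (pb X h g) ∘ u ≡ p (pb X h g) ∘ v → u ≡ v
  q-jointly-monic {Y} {X} {A} {h} {g} {u} {v} eq ep = trans (uniq u refl refl) (sym (uniq v (sym eq) (sym eπ)))
    where
    π = subst (Hom (pb X h g)) (ft-pb X h g) (p (pb X h g))
    eπ : π ∘ u ≡ π ∘ v
    eπ = ≈⇒≡ (≈-trans (∘-cong (castᶜ-≈ (ft-pb X h g) _) refl)
             (≈-trans (≡⇒≈ ep) (∘-cong (≈-sym (castᶜ-≈ (ft-pb X h g) _)) refl)))
    sq : p X ∘ (q X h g ∘ u) ≡ g ∘ (π ∘ u)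
    sq = trans (sym (assoc _ _ _)) (trans (cong (_∘ u) (pb-sq X h g)) (assoc _ _ _))
    uniq = proj₂ (proj₂ (pb-pullback X h g (q X h g ∘ u) (π ∘ u) sq))

  -- Composing with `p` gives the identity for both sections, so by the pullback property only the
  -- composites with `q` need comparing. A separate `Q` allows pullbacks that are only
  -- propositionally equal.
  section-unique : ∀ .{h} {g : Hom Y (ft X)} {Q : Hom Z B} →
                   {τ : Hom (ft Z) Z} {τ' : Hom (ft (pb X h g)) (pb X h g)} →
                   Q ≈ q X h g → p Z ∘ τ ≡ id → p (pb X h g) ∘ τ' ≡ id →
                   Q ∘ τ ≈ q X h g ∘ τ' → τ ≈ τ'
  section-unique refl s s' e = ≡⇒≈ (q-jointly-monic (≈⇒≡ e) (trans s (sym s')))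

  pbSec-q : ∀ .{h} {σ : Hom (ft X) X} {ps : p X ∘ σ ≡ id} {g : Hom Y (ft X)} →
            q X h g ∘ proj₁ (pbSec X h σ ps g) ≈ σ ∘ g
  pbSec-q {X} {h = h} {σ} {ps} {g} =
    ≈-trans (∘-cong refl (castᵈ-≈ (sym (ft-pb X h g)) _))
            (≡⇒≈ (proj₁ (proj₁ (proj₂ (pb-pullback X h g (σ ∘ g) id _)))))

  diag-q : ∀ .{h} → q X h (p X) ∘ proj₁ (diag X h) ≈ id {X}
  diag-q {X} {h} =
    ≈-trans (∘-cong refl (castᵈ-≈ (sym (ft-pb X h (p X))) _))
            (≡⇒≈ (proj₁ (proj₁ (proj₂ (pb-pullback X h (p X) id id _)))))

  pbSec-cong : ∀ .{h h'} {σ : Hom (ft X) X} {σ' : Hom (ft X') X'}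
               {ps : p X ∘ σ ≡ id} {ps' : p X' ∘ σ' ≡ id}
               {g : Hom Y (ft X)} {g' : Hom Z (ft X')} →
               σ ≈ σ' → g ≈ g' → proj₁ (pbSec X h σ ps g) ≈ proj₁ (pbSec X' h' σ' ps' g')
  -- Identifying `X` with `X'` first makes the domains `ft X` and `ft X'` agree, so that `eσ` can be
  -- matched.
  pbSec-cong {ps = ps} {ps'} eσ eg with cod-≡ eσ
  pbSec-cong {ps = ps} {ps'} refl refl | refl with uip ps ps'
  ... | refl = refl

  pbSec-id : ∀ .{h} {σ : Hom (ft X) X} {ps : p X ∘ σ ≡ id} →
             σ ≈ proj₁ (pbSec X h σ ps id)
  pbSec-id {X} {h} {σ} {ps} =
    section-unique (≈-sym q-id-≈) ps (proj₂ (pbSec X h σ ps id))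
      (≈-trans (≡⇒≈ (trans (idˡ σ) (sym (idʳ σ)))) (≈-sym (pbSec-q {ps = ps})))

  -- Both sides are sections whose composite with `q X h (a ∘ b)`, split as two factors on the left,
  -- is `σ ∘ (a ∘ b)`.
  pbSec-∘ : ∀ .{h} {σ : Hom (ft X) X} {ps : p X ∘ σ ≡ id} {a : Hom Y (ft X)} .{h'} {b : Hom A Y}
            {b' : Hom A' (ft (pb X h a))} → b' ≈ b →
            let (τ , pτ) = pbSec X h σ ps a in
            proj₁ (pbSec (pb X h a) h' τ pτ b') ≈ proj₁ (pbSec X h σ ps (a ∘ b))
  pbSec-∘ {X} {h = h} {σ} {ps} {a} {h'} {b} {b'} e =
    section-unique {Q = q X h a ∘ q (pb X h a) h' b'} (≈-sym (q-∘-≈ e)) (proj₂ τ₂) (proj₂ τ₁) (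
      (q X h a ∘ q (pb X h a) h' b') ∘ proj₁ τ₂   ≈⟨ ≡⇒≈ (assoc _ _ _) ⟩
      q X h a ∘ (q (pb X h a) h' b' ∘ proj₁ τ₂)   ≈⟨ ∘-cong refl (pbSec-q {ps = proj₂ τ}) ⟩
      q X h a ∘ (proj₁ τ ∘ b')                    ≈⟨ ≡⇒≈ (sym (assoc _ _ _)) ⟩
      (q X h a ∘ proj₁ τ) ∘ b'                    ≈⟨ ∘-cong (pbSec-q {ps = ps}) e ⟩
      (σ ∘ a) ∘ b                                 ≈⟨ ≡⇒≈ (assoc _ _ _) ⟩
      σ ∘ (a ∘ b)                                 ≈⟨ pbSec-q {ps = ps} ⟨
      q X h (a ∘ b) ∘ proj₁ τ₁ ∎)
    where
    τ  = pbSec X h σ ps a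
    τ₁ = pbSec X h σ ps (a ∘ b)
    τ₂ = pbSec (pb X h a) h' (proj₁ τ) (proj₂ τ) b'

  -- Elements of `uB`, lengths and depths.

  sec : (r : Btᵘ n) → Hom (ft (proj₁ r)) (proj₁ r)
  sec (X , e , σ , ps) = σ

  Bᵘ-≡ : {X Y : Bᵘ n} → proj₁ X ≡ proj₁ Y → X ≡ Y
  Bᵘ-≡ {X = X , e} {_ , e'} refl = cong (X ,_) (uip e e')

  -- A section carries its object as codomain, and the other components are equality proofs, hence
  -- unique.
  Btᵘ-≡ : {r r' : Btᵘ n} → sec r ≈ sec r' → r ≡ r'
  Btᵘ-≡ {r = X , e , σ , ps} {X' , e' , σ' , ps'} eq with cod-≡ eq
  ... | refl with eq | uip e e'
  ...   | refl | refl with uip ps ps'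
  ...     | refl = refl

  sec-≡ : {r r' : Btᵘ n} → r ≡ r' → sec r ≈ sec r'
  sec-≡ refl = refl

  Btᵘ-index : (r : Btᵘ n) (r' : Btᵘ n') → sec r ≈ sec r' → n ≡ n'
  Btᵘ-index (X , e , _) (X' , e' , _) eq =
    suc-injective (trans (sym e) (trans (cong l (cod-≡ eq)) e'))

  l-ftⁱ : ∀ i X → i ≤ l X → l X ≡ i + l (ftⁱᴼ i X)
  l-ftⁱ zero    X h = refl
  l-ftⁱ (suc i) X h = trans (sym (l-ft' X (pos h))) (cong suc (l-ftⁱ i (ft X) (pred≤ X h)))

  ft-ftⁱ : ∀ i X → ft (ftⁱᴼ i X) ≡ ftⁱᴼ (suc i) X
  ft-ftⁱ zero    X = refl
  ft-ftⁱ (suc i) X = ft-ftⁱ i (ft X)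

  ft-over : ∀ i {Z} {f : Hom A (ftⁱᴼ i Z)} {g : Hom B X} → f ≈ g → ft X ≡ ftⁱᴼ (suc i) Z
  ft-over i {Z} e = trans (cong ft (sym (cod-≡ e))) (ft-ftⁱ i Z)

  -- The `i` steps of `ft` from `Z` use up exactly `i` of its length; a base of positive length
  -- leaves room for one more. Needed when `qi-q` raises the depth.
  ≤-over : ∀ i {Z} {f : Hom A (ftⁱᴼ i Z)} {g : Hom B X} → i ≤ l Z → f ≈ g → 0 < l X → suc i ≤ l Z
  ≤-over i {Z} h e pX =
    subst (suc i ≤_) (sym (l-ftⁱ i Z h)) (m<m+n i (subst (λ V → 0 < l V) (sym (cod-≡ e)) pX))

  over : ∀ k (X : Bᵘ n) (Z : Bᵘ (k + n)) → proj₁ X ≡ ftⁱᴼ k (proj₁ Z) → X ≡ iter-ft Bᵘ ftᵘ k Z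
  over k X Z e = Bᵘ-≡ (trans e (sym (proj-iter k Z)))

  -- The common form of `Ttᵘ` and `Stᵘ`, along an arbitrary `f` instead of a projection or a
  -- section.
  pull : ∀ i (r : Btᵘ n) → .(suc i ≤ l (proj₁ r)) → Hom A (ftⁱᴼ (suc i) (proj₁ r)) → Btᵘ (l A + i)
  pull {A = A} i (X , _ , σ , ps) h f =
    pbi (suc i) X h f , trans (l-pbi (suc i) X h f) (+-suc (l A) i) ,
    pbSec X (pos h) σ ps (qi i (ft X) (pred≤ X h) f)

  pull-cong : ∀ i (r : Btᵘ n) (r' : Btᵘ n') .{h h'} {f : Hom A (ftⁱᴼ (suc i) (proj₁ r))}
              {f' : Hom A' (ftⁱᴼ (suc i) (proj₁ r'))} →
              sec r ≈ sec r' → f ≈ f' → sec (pull i r h f) ≈ sec (pull i r' h' f')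
  pull-cong i (_ , _ , _ , ps) (_ , _ , _ , ps') er ef =
    pbSec-cong {ps = ps} {ps'} er (qi-cong i (cong ft (cod-≡ er)) ef)

  pull-id : ∀ i (r : Btᵘ n) .{h} {f : Hom A (ftⁱᴼ (suc i) (proj₁ r))} →
            f ≈ id {ftⁱᴼ (suc i) (proj₁ r)} → sec (pull i r h f) ≈ sec r
  pull-id i (X , e , σ , ps) {h} ef =
    ≈-trans (pbSec-cong {ps = ps} {ps} refl (qi-id i {pred≤ X h} ef)) (≈-sym (pbSec-id {h = pos h} {ps = ps}))

  pull-q : ∀ i (r : Btᵘ n) .{h h' hZ} {g : Hom A (ftⁱᴼ (suc i) (proj₁ r))} {f : Hom Y (ft Z)}
           {f' : Hom B (ftⁱᴼ (suc (suc i)) (proj₁ r))} →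
           g ≈ q Z hZ f → f' ≈ f → sec (pull i r h g) ≈ sec (pull (suc i) r h' f')
  pull-q i (X , e , σ , ps) {h} {h'} {hZ} eg ef =
    pbSec-cong {ps = ps} {ps} refl (qi-q i {ft X} {pred≤ X h} {pred≤ X h'} {hZ} eg ef)

  pull-∘ : ∀ i (r : Btᵘ n) .{h} {f : Hom Y (ftⁱᴼ (suc i) (proj₁ r))} .{h'} {g : Hom A Y}
           {g' : Hom A' (ftⁱᴼ (suc i) (pbi (suc i) (proj₁ r) h f))} → g' ≈ g →
           sec (pull i (pull i r h f) h' g') ≈ sec (pull i r h (f ∘ g))
  pull-∘ i (X , e , σ , ps) {h' = h'} eg =
    ≈-trans (pbSec-∘ {ps = ps} (≈-sym (castᶜ-≈ (ft-pb _ _ _) _)))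
            (pbSec-cong {ps = ps} {ps} refl
              (≈-sym (qi-∘ i {h' = pred≤ _ h'} (ft-pb _ _ _) eg (castᶜ-≈ (ft-pb _ _ _) _))))

  -- The sections `s h f` as elements of `uB`.

  s-section : ∀ .(h : 0 < l X) (f : Hom A X) → Btᵘ (l A)
  s-section h f = pb _ h (p _ ∘ f) , l-pb _ h (p _ ∘ f) , mkSec _ h (p _ ∘ f) (s h f) (s-sec h f)

  s-section-≈ : ∀ .(h : 0 < l X) (f : Hom A X) → sec (s-section h f) ≈ s h f
  s-section-≈ {X = X} h f = castᵈ-≈ (sym (ft-pb X h (p X ∘ f))) (s h f)

  q-s-section : ∀ .(h : 0 < l X) (f : Hom A X) → q X h (p X ∘ f) ∘ sec (s-section h f) ≈ f
  q-s-section h f = ≈-trans (∘-cong refl (s-section-≈ h f)) (≡⇒≈ (s-q h f))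

  -- s_f is the pullback of the diagonal along f.
  pull-δ : ∀ (r : Bᵘ (suc n)) .{h h'} {f : Hom A X} {f' : Hom A' (ftⁱᴼ 1 (proj₁ (δᵘ r)))} →
           proj₁ r ≡ X → f' ≈ f → sec (pull 0 (δᵘ r) h' f') ≈ s h f
  pull-δ (X , e) {h} {h'} {f} {f'} refl ef =
    ≈-trans
      -- Both are sections over the pullback of `X` along `p X ∘ f`, and both give `f` after
      -- composition with `q`.
      (section-unique {Q = q X h (p X) ∘ q (pb X h (p X)) h' f'} (≈-sym (q-∘-≈ ef))
        (proj₂ (proj₂ (proj₂ (pull 0 (δᵘ (X , e)) h' f')))) (proj₂ (proj₂ (proj₂ (s-section h f)))) (
        (q X h (p X) ∘ q (pb X h (p X)) h' f') ∘ τ   ≈⟨ ≡⇒≈ (assoc _ _ _) ⟩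
        q X h (p X) ∘ (q (pb X h (p X)) h' f' ∘ τ)   ≈⟨ ∘-cong refl (pbSec-q {ps = proj₂ (diag X h)}) ⟩
        q X h (p X) ∘ (proj₁ (diag X h) ∘ f')        ≈⟨ ≡⇒≈ (sym (assoc _ _ _)) ⟩
        (q X h (p X) ∘ proj₁ (diag X h)) ∘ f'        ≈⟨ ∘-cong diag-q ef ⟩
        id ∘ f                                       ≈⟨ ≡⇒≈ (idˡ f) ⟩
        f                                            ≈⟨ q-s-section h f ⟨
        q X h (p X ∘ f) ∘ sec (s-section h f) ∎))
      (s-section-≈ h f)
    where τ = sec (pull 0 (δᵘ (X , e)) h' f')

-- Homomorphisms of C-systems respect the operations of `uB`.

module _ {o h o' h'} {C : CSystem o h} {C' : CSystem o' h'} (F : CHom C C') where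
  open CSystemProperties C
  private
    module D = CSystemProperties C'
    variable
      A B X Y : Ob
      A' X' Y' : D.Ob
      n : ℕ
  open CHom F
  open UBHom F

  F₁-cong : {f : Hom A B} {g : Hom X Y} → f ≈ g → F₁ f D.≈ F₁ g
  F₁-cong refl = D.refl

  F₁-p : F₁ (p X) D.≈ D.p (F₀ X)
  F₁-p {X} = D.≅⇒≈ refl (F-ft X) (F-p X)

  F₁-q : ∀ .{h h'} {f : Hom A (ft X)} {g : D.Hom A' (D.ft X')} → F₀ X ≡ X' → F₁ f D.≈ g →
         F₁ (q X h f) D.≈ D.q X' h' g
  F₁-q {X = X} {h = h} {f = f} e eg =
    D.≈-trans (D.≅⇒≈ (F-pb X h f) refl (F-q X h f))
              (D.q-cong e (D.≈-trans (D.castᶜ-≈ (F-ft X) (F₁ f)) eg))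

  F₁-qi : ∀ i .{h h'} {f : Hom A (ftⁱᴼ i X)} {g : D.Hom A' (D.ftⁱᴼ i X')} →
          F₀ X ≡ X' → F₁ f D.≈ g → F₁ (qi i X h f) D.≈ D.qi i X' h' g
  F₁-qi zero e eg = eg
  F₁-qi {X = X} (suc i) e eg = F₁-q e (F₁-qi i (trans (F-ft X) (cong D.ft e)) eg)

  F-section : {σ : Hom (ft X) X} → p X ∘ σ ≡ id →
              D.p (F₀ X) D.∘ D.castᵈ (F-ft X) (F₁ σ) ≡ D.id
  F-section {X} {σ} ps =
    sec-cast₂ D.cat (F-ft X) (F₁ (p X)) (D.p (F₀ X)) (F₁ σ) (F-p X)
              (trans (sym (F-∘ (p X) σ)) (trans (cong F₁ ps) F-id))

  sec-Btmap : (r : Btᵘ n) → D.sec (Btmapᵘ r) D.≈ F₁ (sec r)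
  sec-Btmap (X , _ , σ , _) = D.castᵈ-≈ (F-ft X) (F₁ σ)

  -- Since `F` preserves `p` and `q`, the image of `τ` is again a section over a pullback, and
  -- `section-unique` applies in `C'`. This handles pulled-back sections and diagonals alike.
  F₁-section-unique : ∀ .{h h'} {f : Hom A (ft X)} {g : D.Hom A' (D.ft X')} →
      F₀ X ≡ X' → F₁ f D.≈ g → {τ : Hom (ft (pb X h f)) (pb X h f)} → p (pb X h f) ∘ τ ≡ id →
      {τ' : D.Hom (D.ft (D.pb X' h' g)) (D.pb X' h' g)} → D.p (D.pb X' h' g) D.∘ τ' ≡ D.id →
      F₁ (q X h f ∘ τ) D.≈ D.q X' h' g D.∘ τ' → F₁ τ D.≈ τ'
  F₁-section-unique eX ef {τ} pτ pτ' e =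
    D.≈-trans (D.≈-sym (D.castᵈ-≈ (F-ft _) (F₁ τ)))
      (D.section-unique (F₁-q eX ef) (F-section pτ) pτ'
        (D.≈-trans (D.∘-cong D.refl (D.castᵈ-≈ (F-ft _) (F₁ τ)))
                   (D.≈-trans (D.≡⇒≈ (sym (F-∘ _ τ))) e)))

  F₁-pbSec : ∀ .{h h'} {σ : Hom (ft X) X} {σ' : D.Hom (D.ft X') X'}
             {ps : p X ∘ σ ≡ id} {ps' : D.p X' D.∘ σ' ≡ D.id}
             {f : Hom A (ft X)} {g : D.Hom A' (D.ft X')} →
             F₁ σ D.≈ σ' → F₁ f D.≈ g →
             F₁ (proj₁ (pbSec X h σ ps f)) D.≈ proj₁ (D.pbSec X' h' σ' ps' g)
  F₁-pbSec {X = X} {X'} {h = h} {h'} {σ} {σ'} {ps} {ps'} {f} {g} eσ eg =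
    F₁-section-unique (D.cod-≡ eσ) eg (proj₂ (pbSec X h σ ps f)) (proj₂ (D.pbSec X' h' σ' ps' g))
      (D.≈-trans (F₁-cong (pbSec-q {ps = ps}))
        (D.≈-trans (D.≡⇒≈ (F-∘ σ f))
          (D.≈-trans (D.∘-cong eσ eg) (D.≈-sym (D.pbSec-q {ps = ps'})))))

  F₁-diag : ∀ .{h h'} → F₁ (proj₁ (diag X h)) D.≈ proj₁ (D.diag (F₀ X) h')
  F₁-diag {X} {h} {h'} =
    F₁-section-unique refl F₁-p (proj₂ (diag X h)) (proj₂ (D.diag (F₀ X) h'))
      (D.≈-trans (F₁-cong diag-q) (D.≈-trans (D.≡⇒≈ F-id) (D.≈-sym D.diag-q)))

  restrict-p : ∀ Y {A A'} (e : ft Y ≡ A) (e' : D.ft (F₀ Y) ≡ A') →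
               F₁ (castᶜ e (p Y)) D.≈ D.castᶜ e' (D.p (F₀ Y))
  restrict-p Y e e' = D.≈-trans (F₁-cong (castᶜ-≈ e (p Y)))
                                (D.≈-trans F₁-p (D.≈-sym (D.castᶜ-≈ e' _)))

  restrict-sec : (r : Btᵘ n) (e : proj₁ r ≡ A) (e' : F₀ (proj₁ r) ≡ A') →
                 F₁ (castᶜ e (sec r)) D.≈ D.castᶜ e' (D.sec (Btmapᵘ r))
  restrict-sec r e e' = D.≈-trans (F₁-cong (castᶜ-≈ e (sec r)))
                                  (D.≈-trans (D.≈-sym (sec-Btmap r)) (D.≈-sym (D.castᶜ-≈ e' _)))

  -- The pulled-back object is the domain of `qi`, so the equation is read off from the preservation
  -- of `qi`.
  Bmap-T : ∀ n k Y X e e' → Bmapᵘ (Tᵘ n k Y X e) ≡ D.Tᵘ n k (Bmapᵘ Y) (Bmapᵘ X) e'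
  Bmap-T n k Y X e e' = D.Bᵘ-≡ (D.dom-≡
    (F₁-qi (suc k) {h = len≤ (proj₁ X) (proj₂ X)} {h' = D.len≤ (F₀ (proj₁ X)) (proj₂ (Bmapᵘ X))} refl
      (restrict-p (proj₁ Y) (trans (cong proj₁ e) (proj-iter (suc k) X))
                  (trans (cong proj₁ e') (D.proj-iter (suc k) (Bmapᵘ X))))))

  Bmap-S : ∀ n k r X e e' → Bmapᵘ (Sᵘ n k r X e) ≡ D.Sᵘ n k (Btmapᵘ r) (Bmapᵘ X) e'
  Bmap-S n k r X e e' = D.Bᵘ-≡ (D.dom-≡
    (F₁-qi (suc k) {h = len≤ (proj₁ X) (proj₂ X)} {h' = D.len≤ (F₀ (proj₁ X)) (proj₂ (Bmapᵘ X))} refl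
      (restrict-sec r (trans (cong proj₁ e) (proj-iter (suc k) X))
                    (trans (cong proj₁ e') (D.proj-iter (suc k) (Bmapᵘ X))))))

  F₁-pull : ∀ i (r : Btᵘ n) .{h h'} {f : Hom A (ftⁱᴼ (suc i) (proj₁ r))}
            {g : D.Hom A' (D.ftⁱᴼ (suc i) (F₀ (proj₁ r)))} →
            F₁ f D.≈ g → D.sec (Btmapᵘ (pull i r h f)) D.≈ D.sec (D.pull i (Btmapᵘ r) h' g)
  F₁-pull i r@(X , _ , σ , ps) {h} {h'} {f} {g} eg =
    D.≈-trans (sec-Btmap (pull i r h f))
      (F₁-pbSec {h = pos h} {D.pos h'} {ps = ps} {ps' = proj₂ (proj₂ (proj₂ (Btmapᵘ r)))}
        (D.≈-sym (sec-Btmap r))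
        (F₁-qi i {h = pred≤ X h} {D.pred≤ (F₀ X) h'} (F-ft X) eg))

  Btmap-T : ∀ n k Y r e e' → Btmapᵘ (Ttᵘ n k Y r e) ≡ D.Ttᵘ n k (Bmapᵘ Y) (Btmapᵘ r) e'
  Btmap-T n k Y r e e' = D.Btᵘ-≡
    (F₁-pull k r {len≤ {k} {n} _ (proj₁ (proj₂ r))} {D.len≤ {k} {n} _ (proj₁ (proj₂ (Btmapᵘ r)))}
      (restrict-p (proj₁ Y) (trans (cong proj₁ e) (proj-iter (suc k) (∂ᵘ r)))
                  (trans (cong proj₁ e') (D.proj-iter (suc k) (D.∂ᵘ (Btmapᵘ r))))))

  Btmap-S : ∀ n k r r' e e' → Btmapᵘ (Stᵘ n k r r' e) ≡ D.Stᵘ n k (Btmapᵘ r) (Btmapᵘ r') e'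
  Btmap-S n k r r' e e' = D.Btᵘ-≡
    (F₁-pull k r' {len≤ {k} {suc n} _ (proj₁ (proj₂ r'))} {D.len≤ {k} {suc n} _ (proj₁ (proj₂ (Btmapᵘ r')))}
      (restrict-sec r (trans (cong proj₁ e) (proj-iter (suc k) (∂ᵘ r')))
                    (trans (cong proj₁ e') (D.proj-iter (suc k) (D.∂ᵘ (Btmapᵘ r'))))))

  Btmap-δ : (X : Bᵘ (suc n)) → Btmapᵘ (δᵘ X) ≡ D.δᵘ (Bmapᵘ X)
  Btmap-δ X = D.Btᵘ-≡ (D.≈-trans (sec-Btmap (δᵘ X)) F₁-diag)

  uB-isPreBHom : IsPreBHom (uB C) (uB C') (uB-maps {C = C} {C' = C'} F)
  uB-isPreBHom = record
    { ft-comm = λ X → D.Bᵘ-≡ (F-ft (proj₁ X))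
    ; ∂-comm  = λ r → refl
    ; pt-comm = D.Bᵘ-≡ F-pt
    ; T-comm  = Bmap-T
    ; Tt-comm = Btmap-T
    ; S-comm  = Bmap-S
    ; St-comm = Btmap-S
    ; δ-comm  = Btmap-δ
    }

-- Faithfulness.

module _ {o h o' h'} {C : CSystem o h} {C' : CSystem o' h'} where
  open CSystemProperties C
  private module D = CSystemProperties C'

  uB-faithful : (F G : CHom C C') →
                _≈ᴹ_ {P = uB C} {P' = uB C'} (uB-maps {C = C} {C' = C'} F) (uB-maps {C = C} {C' = C'} G) →
                (∀ X → CHom.F₀ F X ≡ CHom.F₀ G X) ×
                (∀ {X Y} (f : Hom X Y) → CHom.F₁ F f ≅ CHom.F₁ G f)
  uB-faithful F G (eB , eBt) = eOb , λ f → D.≈⇒≅ (eHom _ refl f)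
    where
    module F = CHom F
    module G = CHom G
    eOb : ∀ X → F.F₀ X ≡ G.F₀ X
    eOb X = cong proj₁ (eB (X , refl))

    eSec : ∀ {n} (r : Btᵘ n) → F.F₁ (sec r) D.≈ G.F₁ (sec r)
    eSec r = D.≈-trans (D.≈-sym (sec-Btmap F r))
               (D.≈-trans (D.sec-≡ (eBt r)) (sec-Btmap G r))

    eHom : ∀ n {A B} → l B ≡ n → (f : Hom A B) → F.F₁ f D.≈ G.F₁ f
    eHom zero {A} {B} e f =
      -- The images under `F` and `G` have only propositionally equal ends; the casts bring both
      -- into one hom-set with terminal codomain.
      D.≈-trans (D.≡⇒≈ (D.terminal-unique (trans (F.F-l B) e) (F.F₁ f)
                           (D.castᶜ (sym (eOb B)) (D.castᵈ (sym (eOb A)) (G.F₁ f)))))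
        (D.≈-trans (D.castᶜ-≈ (sym (eOb B)) _) (D.castᵈ-≈ (sym (eOb A)) _))
    eHom (suc n) {A} {B} e f =
      D.≈-trans (decompose F) (D.≈-trans (D.∘-cong eq (eSec r)) (D.≈-sym (decompose G)))
      where
      hB : 0 < l B
      hB = subst (0 <_) (sym e) (s≤s z≤n)
      r = s-section hB f
      pos-G : 0 < D.l (G.F₀ B)
      pos-G = subst (0 <_) (sym (G.F-l B)) hB
      decompose : (K : CHom C C') →
        CHom.F₁ K f D.≈ CHom.F₁ K (q B hB (p B ∘ f)) D.∘ CHom.F₁ K (sec r)
      decompose K = D.≈-trans (F₁-cong K (≈-sym (q-s-section hB f))) (D.≡⇒≈ (CHom.F-∘ K _ _))
      eq : F.F₁ (q B hB (p B ∘ f)) D.≈ G.F₁ (q B hB (p B ∘ f))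
      -- `q` is determined by `p B ∘ f`, whose codomain is one shorter, so the induction hypothesis
      -- applies.
      eq = D.≈-trans
        (F₁-q F {h' = pos-G} (eOb B)
          (D.≈-trans (eHom n (suc-injective (trans (l-ft' B hB) e)) (p B ∘ f))
                     (D.≈-sym (D.castᶜ-≈ (G.F-ft B) _))))
        (D.≈-sym (F₁-q G refl (D.≈-sym (D.castᶜ-≈ (G.F-ft B) _))))

-- Fullness: the action on objects and sections.

module Full {o h o' h'} {C : CSystem o h} {C' : CSystem o' h'} (H : PreBHom (uB C) (uB C')) where
  open CSystemProperties C
  open PreBHom H
  open IsPreBHom isHom
  private
    module D = CSystemProperties C'
    variable
      A B X Y Z : Ob
      A' B' X' Y' Z' : D.Ob
      n n' : ℕ

  F₀ : Ob → D.Ob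
  F₀ X = proj₁ (Bmap {l X} (X , refl))

  F₀-Bmap : (X : Bᵘ n) → proj₁ (Bmap X) ≡ F₀ (proj₁ X)
  F₀-Bmap (X , refl) = refl

  F₀-l : ∀ X → D.l (F₀ X) ≡ l X
  F₀-l X = proj₂ (Bmap (X , refl))

  F₀-pt : F₀ pt ≡ D.pt
  F₀-pt = D.l≡0 (F₀ pt) (trans (F₀-l pt) l-pt)

  F₀-ft : ∀ X → F₀ (ft X) ≡ D.ft (F₀ X)
  F₀-ft X = by-length (l X) refl
    where
    by-length : ∀ n → l X ≡ n → F₀ (ft X) ≡ D.ft (F₀ X)
    -- `ft-comm` speaks of positive lengths only; at length 0 both sides reduce to `pt`.
    by-length zero e with l≡0 X e
    ... | refl = trans (cong F₀ ft-pt) (trans F₀-pt (trans (sym D.ft-pt) (cong D.ft (sym F₀-pt))))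
    by-length (suc n) e =
      trans (sym (F₀-Bmap (ftᵘ (X , e))))
            (trans (cong proj₁ (ft-comm (X , e))) (cong D.ft (F₀-Bmap (X , e))))

  F₀-ob : (r : Btᵘ n) → F₀ (proj₁ r) ≡ proj₁ (Btmap r)
  F₀-ob r = trans (sym (F₀-Bmap (∂ᵘ r))) (cong proj₁ (∂-comm r))

  F₀-ftⁱ : ∀ i X → F₀ (ftⁱᴼ i X) ≡ D.ftⁱᴼ i (F₀ X)
  F₀-ftⁱ zero    X = refl
  F₀-ftⁱ (suc i) X = trans (F₀-ftⁱ i (ft X)) (cong (D.ftⁱᴼ i) (F₀-ft X))

  secMap : (r : Btᵘ n) → D.Hom (D.ft (proj₁ (Btmap r))) (proj₁ (Btmap r))
  secMap r = D.sec (Btmap r)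

  -- Matching sections force equal indices and then equal elements, so the action of `H` can be
  -- rewritten along `≈` without transporting indices.
  secMap-cong : (r : Btᵘ n) (r' : Btᵘ n') → sec r ≈ sec r' → secMap r D.≈ secMap r'
  secMap-cong r r' e with Btᵘ-index r r' e
  ... | refl with Btᵘ-≡ {r = r} {r'} e
  ...   | refl = D.refl

  -- Pulling back along g does to the H-images of objects and sections what pulling back
  -- along f does to the originals.
  infix 4 _~_
  record _~_ (f : Hom A B) (g : D.Hom A' B') : Set (o ⊔ h ⊔ o' ⊔ h') where
    field
      cod : F₀ B ≡ B'
      on-ob : ∀ i {Z Z'} (h : i ≤ l Z) .(h' : i ≤ D.l Z') → F₀ Z ≡ Z' →
              ∀ {X X'} {f₁ : Hom X (ftⁱᴼ i Z)} {g₁ : D.Hom X' (D.ftⁱᴼ i Z')} →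
              f₁ ≈ f → g₁ D.≈ g → F₀ (pbi i Z h f₁) ≡ D.pbi i Z' h' g₁
      on-sec : ∀ i {n n'} (r : Btᵘ n) (r' : D.Btᵘ n')
               (h : suc i ≤ l (proj₁ r)) .(h' : suc i ≤ D.l (proj₁ r')) → secMap r D.≈ D.sec r' →
               ∀ {X X'} {f₁ : Hom X (ftⁱᴼ (suc i) (proj₁ r))}
                 {g₁ : D.Hom X' (D.ftⁱᴼ (suc i) (proj₁ r'))} →
               f₁ ≈ f → g₁ D.≈ g → secMap (pull i r h f₁) D.≈ D.sec (D.pull i r' h' g₁)
  open _~_

  -- Closure properties of lifts.

  dom : {f : Hom A B} {g : D.Hom A' B'} → f ~ g → F₀ A ≡ A'
  -- At depth 0 the pullback of the codomain is the domain.
  dom r = on-ob r 0 z≤n z≤n (cod r) refl D.refl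

  ~-resp : {f : Hom A B} {f₁ : Hom X Y} {g : D.Hom A' B'} {g₁ : D.Hom X' Y'} →
           f ≈ f₁ → g D.≈ g₁ → f ~ g → f₁ ~ g₁
  ~-resp refl D.refl r = r

  ~-id : id {A} ~ D.id {F₀ A}
  ~-id = record
    { cod    = refl
    ; on-ob  = λ i h h' e ef eg → trans (cong F₀ (dom-≡ (qi-id i {h} (id-as ef))))
        (trans e (sym (D.dom-≡ (D.qi-id i {h'} (D.id-as eg)))))
    ; on-sec = λ i r r' h h' er ef eg → D.≈-trans (secMap-cong (pull i r h _) r (pull-id i r {h} (id-as ef)))
        (D.≈-trans er (D.≈-sym (D.pull-id i r' {h'} (D.id-as eg))))
    }

  -- Pulling back along a composite is pulling back in two stages at the same depth; what the first
  -- lift yields is the input for the second.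
  ~-∘ : {f : Hom B Y} {g : Hom A B} {f' : D.Hom B' Y'} {g' : D.Hom A' B'} →
        f ~ f' → g ~ g' → f ∘ g ~ f' D.∘ g'
  ~-∘ {Y = Y} {g = g} {g' = g'} rf rg = record
    { cod    = cod rf
    ; on-ob  = λ { i {Z} {Z'} h h' e refl D.refl →
        trans (cong F₀ (dom-≡ (qi-∘-pbi i {Z} {h})))
          (trans (on-ob rg i (≤-pbi i Z h _) (D.≤-pbi i Z' h' _) (on-ob rf i h h' e refl D.refl)
                   (castᶜ-≈ _ _) (D.castᶜ-≈ _ _))
                 (sym (D.dom-≡ (D.qi-∘-pbi i {Z'} {h'})))) }
    ; on-sec = λ { i r r' h h' er refl D.refl →
        D.≈-trans (secMap-cong (pull i r h _)
                    (pull i (pull i r h _) (≤-pbi (suc i) (proj₁ r) h _)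
                       (castᶜ (sym (ftⁱ-pbi (suc i) (proj₁ r) h _)) g))
                    (≈-sym (pull-∘ i r {h} {h' = ≤-pbi (suc i) (proj₁ r) h _} (castᶜ-≈ _ _))))
          (D.≈-trans (on-sec rg i (pull i r h _) (D.pull i r' h' _)
                        (≤-pbi (suc i) (proj₁ r) h _) (D.≤-pbi (suc i) (proj₁ r') h' _)
                        (on-sec rf i r r' h h' er refl D.refl) (castᶜ-≈ _ _) (D.castᶜ-≈ _ _))
            (D.pull-∘ i r' {h'} {h' = D.≤-pbi (suc i) (proj₁ r') h' _}
               (D.castᶜ-≈ (sym (D.ftⁱ-pbi (suc i) (proj₁ r') h' _)) g'))) }
    }

  -- By `qi-q` and `pull-q`, depth `i` along `q` is depth `suc i` along `f`. This step is why lifts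
  -- are tested at every depth.
  ~-q : (h : 0 < l X) (h' : 0 < D.l X') {f : Hom A (ft X)} {g : D.Hom A' (D.ft X')} →
        F₀ X ≡ X' → f ~ g → q X h f ~ D.q X' h' g
  ~-q h h' {f} {g} e r = record
    { cod    = e
    ; on-ob  = λ i {Z} {Z'} hZ hZ' eZ ef eg →
        trans (cong F₀ (dom-≡ (qi-q i {h' = ≤-over i hZ ef h} {hZ = h} ef (castᶜ-≈ (ft-over i ef) f))))
          (trans (on-ob r (suc i) (≤-over i hZ ef h) (D.≤-over i hZ' eg h') eZ
                    (castᶜ-≈ (ft-over i ef) f) (D.castᶜ-≈ (D.ft-over i eg) g))
            (sym (D.dom-≡ (D.qi-q i {h' = D.≤-over i hZ' eg h'} {hZ = h'} eg (D.castᶜ-≈ (D.ft-over i eg) g)))))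
    ; on-sec = λ i ρ ρ' hZ hZ' eρ ef eg →
        D.≈-trans (secMap-cong (pull i ρ hZ _)
                    (pull (suc i) ρ (≤-over (suc i) hZ ef h) (castᶜ (ft-over (suc i) ef) f))
                    (pull-q i ρ {hZ} {≤-over (suc i) hZ ef h} {h} ef (castᶜ-≈ (ft-over (suc i) ef) f)))
          (D.≈-trans (on-sec r (suc i) ρ ρ' (≤-over (suc i) hZ ef h) (D.≤-over (suc i) hZ' eg h') eρ
                       (castᶜ-≈ (ft-over (suc i) ef) f) (D.castᶜ-≈ (D.ft-over (suc i) eg) g))
            (D.≈-sym (D.pull-q i ρ' {hZ'} {D.≤-over (suc i) hZ' eg h'} {h'} eg
               (D.castᶜ-≈ (D.ft-over (suc i) eg) g))))
    }

  -- Provides the compatibility proof on the image side that `T-comm`, `S-comm` and their section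
  -- versions ask for.
  over-image : ∀ k (Z : Bᵘ (k + n)) (Z' : D.Bᵘ (k + n)) (Y' : D.Bᵘ n) →
               F₀ (proj₁ Z) ≡ proj₁ Z' → ftⁱᴼ k (proj₁ Z) ≡ X → F₀ X ≡ proj₁ Y' →
               Y' ≡ iter-ft D.Bᵘ D.ftᵘ k Z'
  over-image k Z Z' Y' eZ refl eY =
    D.over k Y' Z' (trans (sym eY) (trans (F₀-ftⁱ k (proj₁ Z)) (cong (D.ftⁱᴼ k) eZ)))

  l-over : ∀ i (h : i ≤ l Z) → ftⁱᴼ i Z ≡ X → l X ≡ n → l Z ≡ i + n
  l-over {Z} i h refl e = trans (l-ftⁱ i Z h) (cong (i +_) e)

  -- Depth 0 compares domains only. At depth `suc k` the pullbacks are `Tᵘ n k` and `Ttᵘ n k`, so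
  -- `T-comm` and `Tt-comm` give the claim.
  ~-p : (Y : Bᵘ (suc n)) → p (proj₁ Y) ~ D.p (F₀ (proj₁ Y))
  ~-p {n} Yᵘ@(Y , eY) = record { cod = F₀-ft Y ; on-ob = pulls-ob ; on-sec = pulls-sec }
    where
    eY' : F₀ (ft Y) ≡ D.ft (proj₁ (Bmap Yᵘ))
    eY' = trans (F₀-ft Y) (cong D.ft (sym (F₀-Bmap Yᵘ)))

    pulls-ob : ∀ i {Z Z'} (h : i ≤ l Z) .(h' : i ≤ D.l Z') → F₀ Z ≡ Z' →
               ∀ {X X'} {f₁ : Hom X (ftⁱᴼ i Z)} {g₁ : D.Hom X' (D.ftⁱᴼ i Z')} →
               f₁ ≈ p Y → g₁ D.≈ D.p (F₀ Y) → F₀ (pbi i Z h f₁) ≡ D.pbi i Z' h' g₁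
    pulls-ob zero    h h' e ef eg = trans (cong F₀ (dom-≡ ef)) (sym (D.dom-≡ eg))
    pulls-ob (suc k) {Z} h h' e ef eg =
      trans (cong F₀ (dom-≡ (qi-cong (suc k) {h} {len≤ Z (proj₂ Zᵘ)} refl (≈-trans ef (≈-sym (castᶜ-≈ _ (p Y)))))))
        (trans (sym (F₀-Bmap (Tᵘ n k Yᵘ Zᵘ eq)))
          (trans (cong proj₁ (T-comm n k Yᵘ Zᵘ eq eq'))
            (D.dom-≡ (D.qi-cong (suc k) {D.len≤ _ (proj₂ (Bmap Zᵘ))} {h'} (trans (F₀-Bmap Zᵘ) e)
              (D.≈-trans (D.castᶜ-≈ _ (D.p (proj₁ (Bmap Yᵘ))))
                (D.≈-trans (D.p-cong (F₀-Bmap Yᵘ)) (D.≈-sym eg)))))))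
      where
      Zᵘ : Bᵘ (suc k + n)
      Zᵘ = Z , l-over (suc k) h (cod-≡ ef) (l-ftB Y eY)
      eq : ftᵘ Yᵘ ≡ iter-ft Bᵘ ftᵘ (suc k) Zᵘ
      eq = over (suc k) (ftᵘ Yᵘ) Zᵘ (sym (cod-≡ ef))
      eq' : D.ftᵘ (Bmap Yᵘ) ≡ iter-ft D.Bᵘ D.ftᵘ (suc k) (Bmap Zᵘ)
      eq' = over-image (suc k) Zᵘ (Bmap Zᵘ) (D.ftᵘ (Bmap Yᵘ)) (sym (F₀-Bmap Zᵘ)) (cod-≡ ef) eY'

    index : ∀ k {n₁} (r : Btᵘ n₁) → suc k ≤ l (proj₁ r) →
            ftⁱᴼ (suc k) (proj₁ r) ≡ ft Y → n₁ ≡ k + n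
    index k (Z , eZ , _) h e = suc-injective (trans (sym eZ) (l-over (suc k) h e (l-ftB Y eY)))

    pulls-sec : ∀ k {n₁ n'} (r : Btᵘ n₁) (r' : D.Btᵘ n')
                (h : suc k ≤ l (proj₁ r)) .(h' : suc k ≤ D.l (proj₁ r')) → secMap r D.≈ D.sec r' →
                ∀ {X X'} {f₁ : Hom X (ftⁱᴼ (suc k) (proj₁ r))}
                  {g₁ : D.Hom X' (D.ftⁱᴼ (suc k) (proj₁ r'))} →
                f₁ ≈ p Y → g₁ D.≈ D.p (F₀ Y) → secMap (pull k r h f₁) D.≈ D.sec (D.pull k r' h' g₁)
    -- The object of `r` lies `suc k` levels above one of length `n`, which puts `r` in
    -- `Btᵘ (k + n)`, where `Ttᵘ n k` acts.
    pulls-sec k r r' h h' er ef eg with index k r h (cod-≡ ef)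
    ... | refl =
      D.≈-trans (secMap-cong (pull k r h _) (Ttᵘ n k Yᵘ r eq)
                  (pull-cong k r r {h} {len≤ {k} {n} _ (proj₁ (proj₂ r))} refl
                     (≈-trans ef (≈-sym (castᶜ-≈ _ (p Y))))))
        (D.≈-trans (D.sec-≡ (Tt-comm n k Yᵘ r eq eq'))
          (D.pull-cong k (Btmap r) r' {D.len≤ {k} {n} _ (proj₁ (proj₂ (Btmap r)))} {h'} er
              (D.≈-trans (D.castᶜ-≈ _ (D.p (proj₁ (Bmap Yᵘ))))
                (D.≈-trans (D.p-cong (F₀-Bmap Yᵘ)) (D.≈-sym eg)))))
      where
      eq : ftᵘ Yᵘ ≡ iter-ft Bᵘ ftᵘ (suc k) (∂ᵘ r)
      eq = over (suc k) (ftᵘ Yᵘ) (∂ᵘ r) (sym (cod-≡ ef))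
      eq' : D.ftᵘ (Bmap Yᵘ) ≡ iter-ft D.Bᵘ D.ftᵘ (suc k) (D.∂ᵘ (Btmap r))
      eq' = over-image (suc k) (∂ᵘ r) (D.∂ᵘ (Btmap r)) (D.ftᵘ (Bmap Yᵘ)) (F₀-ob r) (cod-≡ ef) eY'

  -- As for projections, with `S-comm` and `St-comm`; the base `Y` now has length `suc n`.
  ~-sec : (r : Btᵘ n) → sec r ~ secMap r
  ~-sec {n} r₀@(Y , eY , σ , _) = record { cod = F₀-ob r₀ ; on-ob = pulls-ob ; on-sec = pulls-sec }
    where
    pulls-ob : ∀ i {Z Z'} (h : i ≤ l Z) .(h' : i ≤ D.l Z') → F₀ Z ≡ Z' →
               ∀ {X X'} {f₁ : Hom X (ftⁱᴼ i Z)} {g₁ : D.Hom X' (D.ftⁱᴼ i Z')} →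
               f₁ ≈ σ → g₁ D.≈ secMap r₀ → F₀ (pbi i Z h f₁) ≡ D.pbi i Z' h' g₁
    pulls-ob zero    h h' e ef eg =
      trans (cong F₀ (dom-≡ ef)) (trans (F₀-ft Y) (trans (cong D.ft (F₀-ob r₀)) (sym (D.dom-≡ eg))))
    pulls-ob (suc k) {Z} h h' e ef eg =
      trans (cong F₀ (dom-≡ (qi-cong (suc k) {h} {len≤ Z (proj₂ Zᵘ)} refl (≈-trans ef (≈-sym (castᶜ-≈ _ σ))))))
        (trans (sym (F₀-Bmap (Sᵘ n k r₀ Zᵘ eq)))
          (trans (cong proj₁ (S-comm n k r₀ Zᵘ eq eq'))
            (D.dom-≡ (D.qi-cong (suc k) {D.len≤ _ (proj₂ (Bmap Zᵘ))} {h'} (trans (F₀-Bmap Zᵘ) e)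
              (D.≈-trans (D.castᶜ-≈ _ (secMap r₀)) (D.≈-sym eg))))))
      where
      Zᵘ : Bᵘ (suc k + suc n)
      Zᵘ = Z , l-over (suc k) h (cod-≡ ef) eY
      eq : ∂ᵘ r₀ ≡ iter-ft Bᵘ ftᵘ (suc k) Zᵘ
      eq = over (suc k) (∂ᵘ r₀) Zᵘ (sym (cod-≡ ef))
      eq' : D.∂ᵘ (Btmap r₀) ≡ iter-ft D.Bᵘ D.ftᵘ (suc k) (Bmap Zᵘ)
      eq' = over-image (suc k) Zᵘ (Bmap Zᵘ) (D.∂ᵘ (Btmap r₀)) (sym (F₀-Bmap Zᵘ)) (cod-≡ ef) (F₀-ob r₀)

    index : ∀ k {n₁} (r : Btᵘ n₁) → suc k ≤ l (proj₁ r) →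
            ftⁱᴼ (suc k) (proj₁ r) ≡ Y → n₁ ≡ k + suc n
    index k (Z , eZ , _) h e = suc-injective (trans (sym eZ) (l-over (suc k) h e eY))

    pulls-sec : ∀ k {n₁ n'} (r : Btᵘ n₁) (r' : D.Btᵘ n')
                (h : suc k ≤ l (proj₁ r)) .(h' : suc k ≤ D.l (proj₁ r')) → secMap r D.≈ D.sec r' →
                ∀ {X X'} {f₁ : Hom X (ftⁱᴼ (suc k) (proj₁ r))}
                  {g₁ : D.Hom X' (D.ftⁱᴼ (suc k) (proj₁ r'))} →
                f₁ ≈ σ → g₁ D.≈ secMap r₀ → secMap (pull k r h f₁) D.≈ D.sec (D.pull k r' h' g₁)
    pulls-sec k r r' h h' er ef eg with index k r h (cod-≡ ef)
    ... | refl =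
      D.≈-trans (secMap-cong (pull k r h _) (Stᵘ n k r₀ r eq)
                  (pull-cong k r r {h} {len≤ {k} {suc n} _ (proj₁ (proj₂ r))} refl
                     (≈-trans ef (≈-sym (castᶜ-≈ _ σ)))))
        (D.≈-trans (D.sec-≡ (St-comm n k r₀ r eq eq'))
          (D.pull-cong k (Btmap r) r' {D.len≤ {k} {suc n} _ (proj₁ (proj₂ (Btmap r)))} {h'} er
              (D.≈-trans (D.castᶜ-≈ _ (secMap r₀)) (D.≈-sym eg))))
      where
      eq : ∂ᵘ r₀ ≡ iter-ft Bᵘ ftᵘ (suc k) (∂ᵘ r)
      eq = over (suc k) (∂ᵘ r₀) (∂ᵘ r) (sym (cod-≡ ef))
      eq' : D.∂ᵘ (Btmap r₀) ≡ iter-ft D.Bᵘ D.ftᵘ (suc k) (D.∂ᵘ (Btmap r))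
      eq' = over-image (suc k) (∂ᵘ r) (D.∂ᵘ (Btmap r)) (D.∂ᵘ (Btmap r₀)) (F₀-ob r) (cod-≡ ef) (F₀-ob r₀)

  -- Uniqueness of lifts.

  secMap-s : ∀ {n} (e : l X ≡ suc n) .(h : 0 < l X) .(h' : 0 < D.l X') {f : Hom A X} {g : D.Hom A' X'} →
             f ~ g → secMap (s-section h f) D.≈ D.s h' g
  secMap-s {X = X} e h h' {f} {g} r with cod r
  ... | refl =
    -- By `pull-δ` both ends are pullbacks of diagonals; `δ-comm` matches the diagonals and `on-sec`
    -- their pullbacks.
    D.≈-trans (secMap-cong (s-section h f) (pull 0 (δᵘ Xᵘ) hδ (castᶜ eδ f))
                (≈-trans (s-section-≈ h f) (≈-sym (pull-δ Xᵘ {h} {hδ} refl (castᶜ-≈ eδ f)))))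
      (D.≈-trans (on-sec r 0 (δᵘ Xᵘ) (D.δᵘ (Bmap Xᵘ)) hδ hδ' (D.sec-≡ (δ-comm Xᵘ))
                    (castᶜ-≈ eδ f) (D.castᶜ-≈ eδ' g))
        (D.pull-δ (Bmap Xᵘ) {h'} {hδ'} (F₀-Bmap Xᵘ) (D.castᶜ-≈ eδ' g)))
    where
    Xᵘ : Bᵘ (suc _)
    Xᵘ = X , e
    hδ : 1 ≤ l (proj₁ (δᵘ Xᵘ))
    hδ = subst (1 ≤_) (sym (proj₁ (proj₂ (δᵘ Xᵘ)))) (s≤s z≤n)
    hδ' : 1 ≤ D.l (proj₁ (D.δᵘ (Bmap Xᵘ)))
    hδ' = subst (1 ≤_) (sym (proj₁ (proj₂ (D.δᵘ (Bmap Xᵘ))))) (s≤s z≤n)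
    eδ : X ≡ ft (proj₁ (δᵘ Xᵘ))
    eδ = sym (ft-pb X _ (p X))
    eδ' : F₀ X ≡ D.ft (proj₁ (D.δᵘ (Bmap Xᵘ)))
    eδ' = trans (sym (F₀-Bmap Xᵘ)) (sym (D.ft-pb (proj₁ (Bmap Xᵘ)) _ (D.p (proj₁ (Bmap Xᵘ)))))

  -- g = q(p ∘ g) ∘ s_g; the first factor is determined by induction on the length of B,
  -- the second by secMap-s.
  ~-unique : ∀ n {f : Hom A B} → l B ≡ n → {g : D.Hom A' B'} {g' : D.Hom X' Y'} →
             f ~ g → f ~ g' → g D.≈ g'
  ~-unique {B = B} n {f} e {g} {g'} r r' with cod r | cod r' | dom r | dom r'
  ~-unique {B = B} zero    {f} e {g} {g'} r r' | refl | refl | refl | refl =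
    D.≡⇒≈ (D.terminal-unique (trans (F₀-l B) e) g g')
  ~-unique {B = B} (suc n) {f} e {g} {g'} r r' | refl | refl | refl | refl =
    D.≈-trans (D.≡⇒≈ (sym (D.s-q hB' g)))
      (D.≈-trans
        (D.∘-cong
          (D.q-cong refl (~-unique n (l-ftB B e) (~-∘ (~-p (B , e)) r) (~-∘ (~-p (B , e)) r')))
          (D.≈-trans (D.≈-sym (secMap-s e hB hB' r)) (secMap-s e hB hB' r')))
        (D.≡⇒≈ (D.s-q hB' g')))
    where
    hB : 0 < l B
    hB = subst (0 <_) (sym e) (s≤s z≤n)
    hB' : 0 < D.l (F₀ B)
    hB' = subst (0 <_) (sym (F₀-l B)) hB

  -- Existence of lifts.

  record Lift (f : Hom A B) : Set (o ⊔ h ⊔ o' ⊔ h') where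
    field
      {arrow} : D.Hom (F₀ A) (F₀ B)
      rel     : f ~ arrow

  lift-of : {f : Hom A B} {g : D.Hom A' B'} → f ~ g → Lift f
  lift-of r with cod r | dom r
  ... | refl | refl = record { rel = r }

  lift-resp : {f : Hom A B} {g : Hom X Y} → f ≈ g → Lift f → Lift g
  lift-resp refl L = L

  lift-∘ : {f : Hom B X} {g : Hom A B} → Lift f → Lift g → Lift (f ∘ g)
  lift-∘ L M = record { rel = ~-∘ (Lift.rel L) (Lift.rel M) }

  -- Every f is a composite of projections and of factors q(p ∘ f) ∘ s_f: induction on the
  -- length of the codomain, then of the domain.
  lift : ∀ n m → l B ≡ n → l A ≡ m → (f : Hom A B) → Lift f
  lift {B} {A} zero zero eB eA f with l≡0 B eB | l≡0 A eA
  ... | refl | refl = lift-resp (≡⇒≈ (terminal-unique l-pt id f)) (lift-of ~-id)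
  -- Finality of `pt` makes `f` factor through `p A`, and the other factor `t` has a shorter domain.
  lift {B} {A} zero (suc m) eB eA f with l≡0 B eB
  ... | refl = lift-resp (≡⇒≈ (terminal-unique l-pt (t ∘ p A) f))
                 (lift-∘ (lift zero m eB (l-ftB A eA) t) (lift-of (~-p (A , eA))))
    where t = proj₁ (final (ft A))
  lift {B} {A} (suc n) m eB eA f =
    lift-resp (q-s-section hB f)
      (lift-∘ (lift-of (~-q hB hB' refl (~-resp refl (D.≈-sym (D.castᶜ-≈ (F₀-ft B) _)) (Lift.rel L))))
              (lift-of (~-sec (s-section hB f))))
    where
    hB : 0 < l B
    hB = subst (0 <_) (sym eB) (s≤s z≤n)
    hB' : 0 < D.l (F₀ B)
    hB' = subst (0 <_) (sym (F₀-l B)) hB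
    L : Lift (p B ∘ f)
    L = lift n m (l-ftB B eB) eA (p B ∘ f)

  -- The homomorphism assembled from the lifts.

  F₁ : Hom A B → D.Hom (F₀ A) (F₀ B)
  F₁ f = Lift.arrow (lift _ _ refl refl f)

  ~-F₁ : (f : Hom A B) → f ~ F₁ f
  ~-F₁ f = Lift.rel (lift _ _ refl refl f)

  F₁-≈ : {f : Hom A B} {g : D.Hom A' B'} → f ~ g → F₁ f D.≈ g
  F₁-≈ {f = f} r = ~-unique _ refl (~-F₁ f) r

  -- `~-p` covers positive length; the projection of `pt` has a terminal codomain.
  F₁-projection : ∀ X → F₁ (p X) D.≈ D.p (F₀ X)
  F₁-projection X = by-length (l X) refl
    where
    by-length : ∀ n → l X ≡ n → F₁ (p X) D.≈ D.p (F₀ X)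
    by-length zero e with l≡0 X e
    ... | refl = D.≈-trans
      (D.≡⇒≈ (D.terminal-unique (trans (F₀-l (ft pt)) (trans (cong l ft-pt) l-pt))
                (F₁ (p pt)) (D.castᶜ (sym (F₀-ft pt)) (D.p (F₀ pt)))))
      (D.castᶜ-≈ (sym (F₀-ft pt)) _)
    by-length (suc n) e = F₁-≈ (~-p (X , e))

  ~-F₁-castᶜ : ∀ X (f : Hom A (ft X)) → f ~ D.castᶜ (F₀-ft X) (F₁ f)
  ~-F₁-castᶜ X f = ~-resp refl (D.≈-sym (D.castᶜ-≈ (F₀-ft X) (F₁ f))) (~-F₁ f)

  -- The fields of `CHom` give positivity irrelevantly, whereas lifts use it relevantly;
  -- decidability of `<` recovers it.
  positive : ∀ X → .(0 < l X) → 0 < l X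
  positive X h = recompute (0 <? l X) h

  positive′ : ∀ X → .(0 < l X) → 0 < D.l (F₀ X)
  positive′ X h = subst (0 <_) (sym (F₀-l X)) (positive X h)

  hom : CHom C C'
  hom = record
    { F₀   = F₀
    ; F₁   = F₁
    ; F-id = D.≈⇒≡ (F₁-≈ ~-id)
    ; F-∘  = λ f g → D.≈⇒≡ (F₁-≈ (~-∘ (~-F₁ f) (~-F₁ g)))
    ; F-l  = F₀-l
    ; F-pt = F₀-pt
    ; F-ft = F₀-ft
    ; F-p  = λ X → D.≈⇒≅ (F₁-projection X)
    -- Depth 1 of the lift condition, because `pbi 1` is `pb`.
    ; F-pb = λ X h f → on-ob (~-F₁-castᶜ X f) 1 (positive X h) (positive′ X h) refl refl D.refl
    ; F-q  = λ X h f → D.≈⇒≅ (F₁-≈ (~-q (positive X h) (positive′ X h) refl (~-F₁-castᶜ X f)))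
    -- `~-sec` lifts `s h f` to its image under `H`, which `secMap-s` identifies with the section of
    -- `F₁ f`.
    ; F-s  = λ {Y} {X} h f → D.≈⇒≅ (F₁-≈ (~-resp (s-section-≈ h f)
               (secMap-s (sym (l-ft' X (positive X h))) h (positive′ X h) (~-F₁ f)) (~-sec (s-section h f))))
    }

  maps-hom : _≈ᴹ_ {P = uB C} {P' = uB C'} (uB-maps {C = C} {C' = C'} hom) maps
  maps-hom = (λ X → D.Bᵘ-≡ (sym (F₀-Bmap X))) ,
             (λ r → D.Btᵘ-≡ (D.≈-trans (sec-Btmap hom r) (F₁-≈ (~-sec r))))

theorem2p4 : ∀ {o h o' h' : Level} (C : CSystem o h) (C' : CSystem o' h') →
    -- uB sends homomorphisms of C-systems to homomorphisms of unital pre-B-systems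
    ((F : CHom C C') → IsPreBHom (uB C) (uB C') (uB-maps {C = C} {C' = C'} F)) ×
    -- faithful
    ((F G : CHom C C') →
      _≈ᴹ_ {P = uB C} {P' = uB C'} (uB-maps {C = C} {C' = C'} F) (uB-maps {C = C} {C' = C'} G) →
      (∀ X → CHom.F₀ F X ≡ CHom.F₀ G X) ×
      (∀ {X Y} (f : CSystem.Hom C X Y) → CHom.F₁ F f ≅ CHom.F₁ G f)) ×
    -- full
    ((H : PreBHom (uB C) (uB C')) →
      Σ (CHom C C') λ F →
        _≈ᴹ_ {P = uB C} {P' = uB C'} (uB-maps {C = C} {C' = C'} F) (PreBHom.maps H))
theorem2p4 C C' =
  uB-isPreBHom {C = C} {C' = C'} ,
  uB-faithful {C = C} {C' = C'} ,
  λ H → Full.hom {C = C} {C' = C'} H , Full.maps-hom {C = C} {C' = C'} H
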